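{- For every positive integer $k\leq 10$, there is no tournament $T$ having two distinct minimal $\tau$-retentive sets $R_1$ and $R_2$ with $|R_1|=5$ and $|R_2|=k$.
   Context: A tournament $T$ consists of a finite vertex set $V(T)$ and an asymmetric, complete binary relation $\succ$ on $V(T)$ ($x$ dominates $y$ if $x\succ y$). For $v\in V(T)$ let $N^-_T(v)=\{u\in V(T): u\succ v\}$; for $B\subseteq V(T)$, $T[B]$ is the induced subtournament. The tournament equilibrium set $\tau$ is defined recursively: a nonempty $A\subseteq V(T)$ is $\tau$-retentive if for every $v\in A$ with $N^-_T(v)\neq\emptyset$, $\tau(T[N^-_T(v)])\subseteq A$; $A$ is a minimal $\tau$-retentive set if no $\tau$-retentive set of $T$ is a proper subset of $A$; $\tau(T)$ is the union of all minimal $\tau$-retentive sets of $T$. -}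

module Defs where

open import Data.Nat using (ℕ; zero; suc)
open import Data.Bool using (Bool; true; false; not; _∧_)
open import Data.Fin using (Fin)
open import Data.Fin.Subset using (Subset; _∈_; _⊆_; ⊤; Nonempty; inside; outside)
open import Data.Vec using (tabulate; lookup)
open import Data.Product using (Σ; _×_; ∃)
open import Data.Empty using (⊥)
open import Relation.Binary.PropositionalEquality using (_≡_; _≢_)

record Tournament (n : ℕ) : Set where
  field
    beats   : Fin n → Fin n → Bool
    irrefl  : ∀ x → beats x x ≡ false
    tourn   : ∀ x y → x ≢ y → beats x y ≡ not (beats y x)

open Tournament public

module _ {n : ℕ} (T : Tournament n) where

  InNbhd : Subset n → Fin n → Subset n
  InNbhd B v = tabulate λ u → toSide (isIn (lookup B u) ∧ beats T u v)
    where
      isIn : _ → Bool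
      isIn inside  = true
      isIn outside = false
      toSide : Bool → _
      toSide true  = inside
      toSide false = outside

  -- τ(T[B]) as a membership predicate, defined by recursion on a fuel
  -- parameter k.  It computes the true τ(T[B]) whenever |B| ≤ k
  -- (each recursive call is on N⁻_B(v), which excludes v ∈ B).
  -- Retentive k B A : A is a τ-retentive set of T[B] (using τ with fuel k
  -- on the in-neighbourhoods).
  τ : ℕ → Subset n → Fin n → Set

  Retentive : ℕ → Subset n → Subset n → Set
  Retentive k B A =
    Nonempty A × A ⊆ B ×
    (∀ v → v ∈ A → Nonempty (InNbhd B v) →
       ∀ u → τ k (InNbhd B v) u → u ∈ A)

  MinRetentive : ℕ → Subset n → Subset n → Set
  MinRetentive k B A =
    Retentive k B A × (∀ A′ → Retentive k B A′ → A′ ⊆ A → A′ ≡ A)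

  τ zero    B x = ⊥
  τ (suc k) B x = ∃ λ A → MinRetentive k B A × x ∈ A

  -- Minimal τ-retentive sets of T itself (B = all vertices; fuel n
  -- suffices since every in-neighbourhood has at most n - 1 vertices).
  IsMinimalTauRetentive : Subset n → Set
  IsMinimalTauRetentive A = MinRetentive n ⊤ A

{-# OPTIONS --safe #-}
module Submission where

-- Write D(v) for the in-neighbourhood of v.  By induction along τ, a retentive set with at most
-- four elements contains an undominated vertex or a 3-cycle whose in-neighbourhoods are pairwise
-- disjoint, and one with at most five elements may also be a pentagon (a 5-cycle in which cyclically
-- consecutive vertices have disjoint in-neighbourhoods) or an inflated 3-cycle.  Since a tournament
-- on at most ten vertices has a vertex of in-degree at most four, some v in R₂ has D(v) empty, or
-- some p ∈ R₂ undominated in D(v), or a 3-cycle in R₂ ∩ D(v) whose in-neighbourhoods are pairwise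
-- disjoint inside D(v).  In the last case every vertex of R₁ in D(v) is dominated by two vertices of
-- the 3-cycle; so in each case two vertices r, s of R₁ in D(v) would have a common dominator.  The structure of
-- R₁ provides such r, s with D(r) ∩ D(s) empty, unless R₁ is an inflated 3-cycle and v dominates
-- its vertex w; then counting the dominators of the other four vertices gives the contradiction.
--
-- Existence of minimal retentive sets is used only under ¬¬, which suffices as the goal is ⊥.

open import Defs
open import Data.Nat using (ℕ; zero; suc; _+_; _≤_; _<_; z≤n; s≤s; s≤s⁻¹)
open import Data.Nat.Properties as ℕ using (+-0-commutativeMonoid; ≤-trans; ≤-reflexive)
open import Data.Nat.Induction using (<-wellFounded)
open import Data.Bool using (Bool; true; false; not; _∧_; if_then_else_)
open import Data.Fin using (Fin; zero; suc)
open import Data.Fin.Properties using (_≟_; sequence)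
open import Data.Fin.Subset
  using (Subset; ∣_∣; _∈_; _∉_; _⊆_; _-_; _∩_; ⊤; Nonempty; inside; outside)
open import Data.Fin.Subset.Properties
open import Data.Vec using ([]; _∷_; lookup; tabulate)
open import Data.Vec.Properties using ([]=⇒lookup; lookup⇒[]=; lookup∘tabulate)
open import Data.List using ([]; _∷_; length)
open import Data.List.Membership.Propositional using () renaming (_∈_ to _∈ₗ_)
open import Data.List.Relation.Unary.Any using (here; there)
open import Data.List.Relation.Unary.All as All using (All; []; _∷_)
open import Data.List.Relation.Unary.AllPairs using ([]; _∷_)
open import Data.List.Relation.Unary.Unique.Propositional using (Unique)
open import Data.Product using (∃; _×_; _,_; proj₁; proj₂)
open import Data.Sum using (_⊎_; inj₁; inj₂)
open import Data.Empty using (⊥)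
open import Effect.Monad using (RawMonad)
open import Function using (_∘_; case_of_)
open import Induction.WellFounded using (Acc; acc)
open import Relation.Nullary using (¬_; yes; no; contradiction)
open import Relation.Nullary.Decidable using (decidable-stable)
open import Relation.Nullary.Negation using (¬¬-Monad)
open import Relation.Binary.PropositionalEquality using (_≡_; _≢_; refl; sym; trans; cong; ≢-sym)
open import Algebra.Properties.CommutativeMonoid.Sum +-0-commutativeMonoid
  using (sum; sum-syntax; sum-cong-≗; ∑-distrib-+; ∑-comm)

-- Counting in finite subsets.

-- Deleting `x` from `A` shortens the list and lowers the bound together; once the list is empty,
-- `A` has no element left.
unique-exhausts : ∀ {n} (A : Subset n) xs → Unique xs → All (_∈ A) xs → ∣ A ∣ ≤ length xs →
  ∀ {u} → u ∈ A → u ∈ₗ xs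
unique-exhausts A [] _ _ ∣A∣≤0 u∈A with ≤-trans (x∈p⇒∣p-x∣<∣p∣ u∈A) ∣A∣≤0
... | ()
unique-exhausts A (x ∷ xs) (x∉xs ∷ xs!) (x∈A ∷ xs⊆A) ∣A∣≤ {u} u∈A with u ≟ x
... | yes u≡x = here u≡x
... | no u≢x = there (unique-exhausts (A - x) xs xs!
        (All.zipWith (λ (x≢y , y∈A) → x∈p∧x≢y⇒x∈p-y y∈A (≢-sym x≢y)) (x∉xs , xs⊆A))
        (s≤s⁻¹ (≤-trans (x∈p⇒∣p-x∣<∣p∣ x∈A) ∣A∣≤)) (x∈p∧x≢y⇒x∈p-y u∈A u≢x))

unique-length : ∀ {n} {A : Subset n} {xs} → Unique xs → All (_∈ A) xs → length xs ≤ ∣ A ∣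
unique-length {A = A} {[]} _ _ = z≤n
unique-length {A = A} {x ∷ xs} (x∉xs ∷ xs!) (x∈A ∷ xs⊆A) =
  ≤-trans (s≤s (unique-length xs! (All.zipWith (λ (x≢y , y∈A) → x∈p∧x≢y⇒x∈p-y y∈A (≢-sym x≢y)) (x∉xs , xs⊆A))))
    (x∈p⇒∣p-x∣<∣p∣ x∈A)

-- `InNbhd` tabulates through local functions that cannot be named from outside; with `refl` as the
-- equation, unification finds `f`.
lookup-≡-tabulate : ∀ {n f} {p : Subset n} → p ≡ tabulate f → ∀ i → lookup p i ≡ f i
lookup-≡-tabulate {f = f} refl = lookup∘tabulate f

χ : Bool → ℕ
χ b = if b then 1 else 0

sum-mono-≤ : ∀ {n} {f g : Fin n → ℕ} → (∀ i → f i ≤ g i) → sum f ≤ sum g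
sum-mono-≤ {zero} f≤g = z≤n
sum-mono-≤ {suc n} f≤g = ℕ.+-mono-≤ (f≤g zero) (sum-mono-≤ (f≤g ∘ suc))

∣p∣≡∑χ : ∀ {n} (p : Subset n) → ∣ p ∣ ≡ ∑[ i < n ] χ (lookup p i)
∣p∣≡∑χ [] = refl
∣p∣≡∑χ (inside ∷ p) = cong suc (∣p∣≡∑χ p)
∣p∣≡∑χ (outside ∷ p) = ∣p∣≡∑χ p

-- Tournaments and in-neighbourhoods.

module _ {n : ℕ} (T : Tournament n) where

  infix 4 _⊳_

  _⊳_ : Fin n → Fin n → Set
  x ⊳ y = beats T x y ≡ true

  ⊳-asym : ∀ {x y} → x ⊳ y → ¬ y ⊳ x
  ⊳-asym {x} {y} x⊳y y⊳x with x ≟ y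
  ... | yes refl = contradiction (trans (sym x⊳y) (irrefl T x)) λ ()
  ... | no x≢y = contradiction (trans (sym x⊳y) (trans (tourn T x y x≢y) (cong not y⊳x))) λ ()

  ⊳-irrefl : ∀ {x} → ¬ x ⊳ x
  ⊳-irrefl x⊳x = ⊳-asym x⊳x x⊳x

  ⊳⇒≢ : ∀ {x y} → x ⊳ y → x ≢ y
  ⊳⇒≢ x⊳y refl = ⊳-irrefl x⊳y

  ⊳⊳⇒≢ : ∀ {x y z} → x ⊳ y → y ⊳ z → x ≢ z
  ⊳⊳⇒≢ x⊳y y⊳z refl = ⊳-asym x⊳y y⊳z

  ⊳-total : ∀ {x y} → x ≢ y → x ⊳ y ⊎ y ⊳ x
  ⊳-total {x} {y} x≢y with beats T x y in eq
  ... | true = inj₁ refl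
  ... | false = inj₂ (trans (tourn T y x (≢-sym x≢y)) (cong not eq))

  ⋫⇒⊳ : ∀ {x y} → x ≢ y → ¬ x ⊳ y → y ⊳ x
  ⋫⇒⊳ x≢y x⋫y with ⊳-total x≢y
  ... | inj₁ x⊳y = contradiction x⊳y x⋫y
  ... | inj₂ y⊳x = y⊳x

  D : Subset n → Fin n → Subset n
  D = InNbhd T

  lookup-D : ∀ B v u → lookup (D B v) u ≡ lookup B u ∧ beats T u v
  lookup-D B v u with lookup B u | beats T u v | lookup-≡-tabulate {p = D B v} refl u
  ... | true | true | eq = eq
  ... | true | false | eq = eq
  ... | false | _ | eq = eq

  ∈-D⁺ : ∀ {B v u} → u ∈ B → u ⊳ v → u ∈ D B v
  ∈-D⁺ {B} {v} {u} u∈B u⊳v = lookup⇒[]= u (D B v) (trans (lookup-D B v u) both)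
    where
    both : lookup B u ∧ beats T u v ≡ true
    both rewrite []=⇒lookup u∈B = u⊳v

  ∈-D⁻ : ∀ {B v u} → u ∈ D B v → u ∈ B × u ⊳ v
  ∈-D⁻ {B} {v} {u} u∈D with lookup B u in eqB | beats T u v | trans (sym (lookup-D B v u)) ([]=⇒lookup u∈D)
  ... | true | true | _ = lookup⇒[]= u B eqB , refl

  ∣D∣<∣B∣ : ∀ {B v} → v ∈ B → ∣ D B v ∣ < ∣ B ∣
  ∣D∣<∣B∣ {B} v∈B = p⊂q⇒∣p∣<∣q∣ (proj₁ ∘ ∈-D⁻ , _ , v∈B , ⊳-irrefl ∘ proj₂ ∘ ∈-D⁻ {B})

  -- Configurations inside a retentive set.

  Undominated : Subset n → Fin n → Set
  Undominated B x = ∀ {u} → u ∈ B → ¬ u ⊳ x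

  -- This is disjointness of `D B x` and `D B y`.
  Exclusive : Subset n → Fin n → Fin n → Set
  Exclusive B x y = ∀ {u} → u ∈ B → u ⊳ x → ¬ u ⊳ y

  record Triangle (B A : Subset n) (x y z : Fin n) : Set where
    constructor mkTriangle
    field
      x∈ : x ∈ A
      y∈ : y ∈ A
      z∈ : z ∈ A
      x⊳y : x ⊳ y
      y⊳z : y ⊳ z
      z⊳x : z ⊳ x
      xy : Exclusive B x y
      yz : Exclusive B y z
      zx : Exclusive B z x

  rotate : ∀ {B A x y z} → Triangle B A x y z → Triangle B A y z x
  rotate (mkTriangle x∈ y∈ z∈ x⊳y y⊳z z⊳x xy yz zx) = mkTriangle y∈ z∈ x∈ y⊳z z⊳x x⊳y yz zx xy

  data Small (B A : Subset n) : Set where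
    source : ∀ {a} → a ∈ A → Undominated B a → Small B A
    cycle : ∀ {x y z} → Triangle B A x y z → Small B A

  Small-mono : ∀ {B A A′} → A ⊆ A′ → Small B A → Small B A′
  Small-mono A⊆A′ (source a∈A a!) = source (A⊆A′ a∈A) a!
  Small-mono A⊆A′ (cycle (mkTriangle x∈ y∈ z∈ x⊳y y⊳z z⊳x xy yz zx)) =
    cycle (mkTriangle (A⊆A′ x∈) (A⊆A′ y∈) (A⊆A′ z∈) x⊳y y⊳z z⊳x xy yz zx)

  record Pentagon (B A : Subset n) : Set where
    constructor mkPentagon
    field
      {a₀ a₁ a₂ a₃ a₄} : Fin n
      distinct : Unique (a₀ ∷ a₁ ∷ a₂ ∷ a₃ ∷ a₄ ∷ [])
      members : All (_∈ A) (a₀ ∷ a₁ ∷ a₂ ∷ a₃ ∷ a₄ ∷ [])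
      e₀ : Exclusive B a₁ a₀
      e₁ : Exclusive B a₂ a₁
      e₂ : Exclusive B a₃ a₂
      e₃ : Exclusive B a₄ a₃
      e₄ : Exclusive B a₀ a₄

  -- The 3-cycle w ⊳ {a , b , c} ⊳ v ⊳ w with one vertex blown up to a 3-cycle.
  record Inflated (B A : Subset n) : Set where
    constructor mkInflated
    field
      {v w a b c} : Fin n
      v∈ : v ∈ A
      w∈ : w ∈ A
      triangle : Triangle (D B v) (D A v) a b c
      w⊳a : w ⊳ a
      w⊳b : w ⊳ b
      w⊳c : w ⊳ c
      v⊳w : v ⊳ w
      wa : Exclusive B w a
      wb : Exclusive B w b
      wc : Exclusive B w c
      vw : Exclusive B v w

  data Structure (B A : Subset n) : Set where
    small : Small B A → Structure B A
    pentagon : Pentagon B A → Structure B A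
    inflated : Inflated B A → Structure B A

  -- If `D B v` is nonempty, a retentive `A` contains its minimal retentive sets; when `D A v` has
  -- at most four vertices, the induction turns one of them into the second alternative.
  Local : Subset n → Subset n → Fin n → Set
  Local B A v = Undominated B v ⊎ Small (D B v) (D A v)

  -- Equivalently, `p` is a vertex of `A` undominated in `D B v`.
  record Cover (B A : Subset n) (v : Fin n) : Set where
    constructor mkCover
    field
      {p} : Fin n
      p∈ : p ∈ A
      p⊳v : p ⊳ v
      pv : Exclusive B p v

  source⇒cover : ∀ {B A v s} → s ∈ D A v → Undominated (D B v) s → Cover B A v
  source⇒cover s∈D s! with ∈-D⁻ s∈D
  ... | s∈ , s⊳v = mkCover s∈ s⊳v λ u∈ u⊳s u⊳v → s! (∈-D⁺ u∈ u⊳v) u⊳s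

  -- The structure of a set of at most five vertices.

  module _ {B A : Subset n} (A⊆B : A ⊆ B) (∣A∣≤5 : ∣ A ∣ ≤ 5) (loc : ∀ {v} → v ∈ A → Local B A v) where

    -- A 3-cycle in `D A v` is impossible: together with `v` and the dominated `p` and `q` it would
    -- make six vertices of `A`.
    source-or-cover : ∀ {v p q} → v ∈ A → p ∈ A → q ∈ A → p ≢ q → v ⊳ p → v ⊳ q →
      Small B A ⊎ Cover B A v
    source-or-cover v∈ p∈ q∈ p≢q v⊳p v⊳q with loc v∈
    ... | inj₁ v! = inj₁ (source v∈ v!)
    ... | inj₂ (source s∈D s!) = inj₂ (source⇒cover s∈D s!)
    ... | inj₂ (cycle (mkTriangle x∈D y∈D z∈D x⊳y y⊳z z⊳x _ _ _))
      with ∈-D⁻ x∈D | ∈-D⁻ y∈D | ∈-D⁻ z∈D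
    ... | x∈ , x⊳v | y∈ , y⊳v | z∈ , z⊳v = contradiction (unique-length
        ((≢-sym (⊳⇒≢ x⊳v) ∷ ≢-sym (⊳⇒≢ y⊳v) ∷ ≢-sym (⊳⇒≢ z⊳v) ∷ ⊳⇒≢ v⊳p ∷ ⊳⇒≢ v⊳q ∷ [])
         ∷ (⊳⇒≢ x⊳y ∷ ≢-sym (⊳⇒≢ z⊳x) ∷ ⊳⊳⇒≢ x⊳v v⊳p ∷ ⊳⊳⇒≢ x⊳v v⊳q ∷ [])
         ∷ (⊳⇒≢ y⊳z ∷ ⊳⊳⇒≢ y⊳v v⊳p ∷ ⊳⊳⇒≢ y⊳v v⊳q ∷ [])
         ∷ (⊳⊳⇒≢ z⊳v v⊳p ∷ ⊳⊳⇒≢ z⊳v v⊳q ∷ [])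
         ∷ (p≢q ∷ []) ∷ [] ∷ [])
        (v∈ ∷ x∈ ∷ y∈ ∷ z∈ ∷ p∈ ∷ q∈ ∷ [])) (ℕ.<⇒≱ (s≤s ∣A∣≤5))

    -- Here `w` covers `a` without being its predecessor `c` on the 3-cycle. Then `a`, `b`, `c`,
    -- `v`, `w` exhaust `A`, which leaves few candidates for the covers of `b`, `c` and `w`.
    inflate : ∀ {v w a b c} → v ∈ A → Triangle (D B v) (D A v) a b c →
      w ∈ A → w ⊳ a → Exclusive B w a → w ≢ c → Structure B A
    inflate {v} {w} {a} {b} {c} v∈ t@(mkTriangle a∈D b∈D c∈D a⊳b b⊳c c⊳a _ _ _) w∈ w⊳a wa w≢c
      with ∈-D⁻ a∈D | ∈-D⁻ b∈D | ∈-D⁻ c∈D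
    ... | a∈ , a⊳v | b∈ , b⊳v | c∈ , c⊳v = result
      where
      w⊳c : w ⊳ c
      w⊳c = ⋫⇒⊳ (≢-sym w≢c) λ c⊳w → wa (A⊆B c∈) c⊳w c⊳a

      w≢b : w ≢ b
      w≢b = ⊳⊳⇒≢ w⊳a a⊳b

      exhausts : ∀ {u} → u ∈ A → u ∈ₗ a ∷ b ∷ c ∷ v ∷ w ∷ []
      exhausts = unique-exhausts A _
        ((⊳⇒≢ a⊳b ∷ ≢-sym (⊳⇒≢ c⊳a) ∷ ⊳⇒≢ a⊳v ∷ ≢-sym (⊳⇒≢ w⊳a) ∷ [])
         ∷ (⊳⇒≢ b⊳c ∷ ⊳⇒≢ b⊳v ∷ ≢-sym w≢b ∷ [])
         ∷ (⊳⇒≢ c⊳v ∷ ≢-sym w≢c ∷ [])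
         ∷ (≢-sym (⊳⊳⇒≢ w⊳a a⊳v) ∷ [])
         ∷ [] ∷ [])
        (a∈ ∷ b∈ ∷ c∈ ∷ v∈ ∷ w∈ ∷ []) ∣A∣≤5

      cover-b : Cover B A b → (b ⊳ w × Exclusive B a b) ⊎ (w ⊳ b × Exclusive B w b)
      cover-b (mkCover p∈ p⊳b pb) with exhausts p∈
      ... | here refl = inj₁ (⋫⇒⊳ w≢b (λ w⊳b → pb (A⊆B w∈) w⊳a w⊳b) , pb)
      ... | there (here refl) = contradiction p⊳b ⊳-irrefl
      ... | there (there (here refl)) = contradiction p⊳b (⊳-asym b⊳c)
      ... | there (there (there (here refl))) = contradiction p⊳b (⊳-asym b⊳v)
      ... | there (there (there (there (here refl)))) = inj₂ (p⊳b , pb)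

      cover-c : Cover B A c → b ⊳ w ⊎ (w ⊳ b × Exclusive B w c)
      cover-c (mkCover p∈ p⊳c pc) with exhausts p∈
      ... | here refl = contradiction p⊳c (⊳-asym c⊳a)
      ... | there (here refl) = inj₁ (⋫⇒⊳ w≢b λ w⊳b → pc (A⊆B w∈) w⊳b w⊳c)
      ... | there (there (here refl)) = contradiction p⊳c ⊳-irrefl
      ... | there (there (there (here refl))) = contradiction p⊳c (⊳-asym c⊳v)
      ... | there (there (there (there (here refl)))) =
        inj₂ (⋫⇒⊳ (≢-sym w≢b) (λ b⊳w → pc (A⊆B b∈) b⊳w b⊳c) , pc)

      cover-w : Cover B A w → (b ⊳ w × Exclusive B b w) ⊎ (v ⊳ w × Exclusive B v w)
      cover-w (mkCover p∈ p⊳w pw) with exhausts p∈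
      ... | here refl = contradiction p⊳w (⊳-asym w⊳a)
      ... | there (here refl) = inj₁ (p⊳w , pw)
      ... | there (there (here refl)) = contradiction p⊳w (⊳-asym w⊳c)
      ... | there (there (there (here refl))) = inj₂ (p⊳w , pw)
      ... | there (there (there (there (here refl)))) = contradiction p⊳w ⊳-irrefl

      result : Structure B A
      result with source-or-cover b∈ c∈ v∈ (⊳⇒≢ c⊳v) b⊳c b⊳v
                | source-or-cover c∈ a∈ v∈ (⊳⇒≢ a⊳v) c⊳a c⊳v
                | source-or-cover w∈ a∈ c∈ (≢-sym (⊳⇒≢ c⊳a)) w⊳a w⊳c
      ... | inj₁ s | _ | _ = small s
      ... | _ | inj₁ s | _ = small s
      ... | _ | _ | inj₁ s = small s
      ... | inj₂ pb | inj₂ pc | inj₂ pw with cover-b pb | cover-c pc | cover-w pw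
      -- The arc between `b` and `w` decides: `b ⊳ w` leaves only the 3-cycle `w`, `a`, `b`, and
      -- `w ⊳ b` only the inflated one.
      ... | inj₁ (b⊳w , ab) | _ | inj₁ (_ , bw) =
        small (cycle (mkTriangle w∈ a∈ b∈ w⊳a a⊳b b⊳w wa ab bw))
      ... | inj₁ (b⊳w , _) | _ | inj₂ (_ , vw) = contradiction b⊳w (vw (A⊆B b∈) b⊳v)
      ... | inj₂ (w⊳b , _) | inj₁ b⊳w | _ = contradiction b⊳w (⊳-asym w⊳b)
      ... | inj₂ (w⊳b , _) | _ | inj₁ (b⊳w , _) = contradiction b⊳w (⊳-asym w⊳b)
      ... | inj₂ (w⊳b , wb) | inj₂ (_ , wc) | inj₂ (v⊳w , vw) =
        inflated (mkInflated v∈ w∈ t w⊳a w⊳b w⊳c v⊳w wa wb wc vw)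

    -- Each vertex of the 3-cycle dominates its successor and `v`, so it has a cover unless `A` is
    -- already `Small`. If all covers are predecessors on the cycle, disjointness extends from
    -- `D B v` to `B`; any other cover serves as the `w` of `inflate`.
    triangle⇒structure : ∀ {v a b c} → v ∈ A → Triangle (D B v) (D A v) a b c → Structure B A
    triangle⇒structure {v} {a} {b} {c} v∈ t@(mkTriangle a∈D b∈D c∈D a⊳b b⊳c c⊳a _ _ _)
      with ∈-D⁻ a∈D | ∈-D⁻ b∈D | ∈-D⁻ c∈D
    ... | a∈ , a⊳v | b∈ , b⊳v | c∈ , c⊳v
      with source-or-cover a∈ b∈ v∈ (⊳⇒≢ b⊳v) a⊳b a⊳v
         | source-or-cover b∈ c∈ v∈ (⊳⇒≢ c⊳v) b⊳c b⊳v
         | source-or-cover c∈ a∈ v∈ (⊳⇒≢ a⊳v) c⊳a c⊳v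
    ... | inj₁ s | _ | _ = small s
    ... | _ | inj₁ s | _ = small s
    ... | _ | _ | inj₁ s = small s
    ... | inj₂ (mkCover {p} p∈ p⊳a pa) | inj₂ (mkCover {q} q∈ q⊳b qb) | inj₂ (mkCover {r} r∈ r⊳c rc)
      with p ≟ c | q ≟ a | r ≟ b
    ... | no p≢c | _ | _ = inflate v∈ t p∈ p⊳a pa p≢c
    ... | _ | no q≢a | _ = inflate v∈ (rotate t) q∈ q⊳b qb q≢a
    ... | _ | _ | no r≢b = inflate v∈ (rotate (rotate t)) r∈ r⊳c rc r≢b
    ... | yes refl | yes refl | yes refl = small (cycle (mkTriangle a∈ b∈ c∈ a⊳b b⊳c c⊳a qb rc pa))

    structure-or-cover : ∀ {v} → v ∈ A → Structure B A ⊎ Cover B A v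
    structure-or-cover v∈ with loc v∈
    ... | inj₁ v! = inj₁ (small (source v∈ v!))
    ... | inj₂ (source s∈D s!) = inj₂ (source⇒cover s∈D s!)
    ... | inj₂ (cycle t) = inj₁ (triangle⇒structure v∈ t)

    -- As `z` dominates `y`, it cannot also dominate `x`. Along a walk of covers this orients the
    -- arcs between vertices two steps apart.
    cover-cover : ∀ {x y z} → z ∈ A → Exclusive B y x → y ⊳ x → z ⊳ y → x ⊳ z
    cover-cover z∈ yx y⊳x z⊳y = ⋫⇒⊳ (⊳⊳⇒≢ z⊳y y⊳x) (yx (A⊆B z∈) z⊳y)

    -- Follow covers from any vertex. A return after three steps closes a 3-cycle; otherwise the
    -- first five vertices exhaust `A`, and `a₅` can only be `a₀`.
    structure : Nonempty A → Structure B A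
    structure (a₀ , m₀) with structure-or-cover m₀
    ... | inj₁ s = s
    ... | inj₂ (mkCover {a₁} m₁ d₀ e₀) with structure-or-cover m₁
    ... | inj₁ s = s
    ... | inj₂ (mkCover {a₂} m₂ d₁ e₁) with structure-or-cover m₂
    ... | inj₁ s = s
    ... | inj₂ (mkCover {a₃} m₃ d₂ e₂) with structure-or-cover m₃
    ... | inj₁ s = s
    ... | inj₂ (mkCover {a₄} m₄ d₃ e₃) with structure-or-cover m₄
    ... | inj₁ s = s
    ... | inj₂ (mkCover {a₅} m₅ d₄ e₄) = result
      where
      closing : ∀ {x y z} → x ∈ A → y ∈ A → z ∈ A → y ⊳ x → z ⊳ y → x ⊳ z →
        Exclusive B y x → Exclusive B z y → Exclusive B x z → Structure B A
      closing x∈ y∈ z∈ y⊳x z⊳y x⊳z yx zy xz =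
        small (cycle (mkTriangle z∈ y∈ x∈ z⊳y y⊳x x⊳z zy yx xz))

      c₀ : a₀ ⊳ a₂
      c₀ = cover-cover m₂ e₀ d₀ d₁
      c₁ : a₁ ⊳ a₃
      c₁ = cover-cover m₃ e₁ d₁ d₂
      c₂ : a₂ ⊳ a₄
      c₂ = cover-cover m₄ e₂ d₂ d₃
      c₃ : a₃ ⊳ a₅
      c₃ = cover-cover m₅ e₃ d₃ d₄

      distinct : a₃ ≢ a₀ → a₄ ≢ a₁ → Unique (a₀ ∷ a₁ ∷ a₂ ∷ a₃ ∷ a₄ ∷ [])
      distinct a₃≢a₀ a₄≢a₁ =
        (≢-sym (⊳⇒≢ d₀) ∷ ⊳⇒≢ c₀ ∷ ≢-sym a₃≢a₀ ∷ ⊳⊳⇒≢ c₀ c₂ ∷ [])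
        ∷ (≢-sym (⊳⇒≢ d₁) ∷ ⊳⇒≢ c₁ ∷ ≢-sym a₄≢a₁ ∷ [])
        ∷ (≢-sym (⊳⇒≢ d₂) ∷ ⊳⇒≢ c₂ ∷ [])
        ∷ (≢-sym (⊳⇒≢ d₃) ∷ [])
        ∷ [] ∷ []

      members : All (_∈ A) (a₀ ∷ a₁ ∷ a₂ ∷ a₃ ∷ a₄ ∷ [])
      members = m₀ ∷ m₁ ∷ m₂ ∷ m₃ ∷ m₄ ∷ []

      result : Structure B A
      result with a₃ ≟ a₀ | a₄ ≟ a₁ | a₅ ≟ a₂
      ... | yes refl | _ | _ = closing m₀ m₁ m₂ d₀ d₁ d₂ e₀ e₁ e₂
      ... | _ | yes refl | _ = closing m₁ m₂ m₃ d₁ d₂ d₃ e₁ e₂ e₃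
      ... | _ | _ | yes refl = closing m₂ m₃ m₄ d₂ d₃ d₄ e₂ e₃ e₄
      ... | no a₃≢a₀ | no a₄≢a₁ | no a₅≢a₂
        with unique-exhausts A _ (distinct a₃≢a₀ a₄≢a₁) members ∣A∣≤5 m₅
      ... | here refl = pentagon (mkPentagon (distinct a₃≢a₀ a₄≢a₁) members e₀ e₁ e₂ e₃ e₄)
      ... | there (here refl) = contradiction refl (⊳⊳⇒≢ c₁ c₃)
      ... | there (there (here refl)) = contradiction refl a₅≢a₂
      ... | there (there (there (here refl))) = contradiction c₃ ⊳-irrefl
      ... | there (there (there (there (here refl)))) = contradiction d₄ ⊳-irrefl

  Structure⇒Small : ∀ {B A} → ∣ A ∣ ≤ 4 → Structure B A → Small B A
  Structure⇒Small _ (small s) = s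
  Structure⇒Small ∣A∣≤4 (pentagon (mkPentagon distinct members _ _ _ _ _)) =
    contradiction (unique-length distinct members) (ℕ.<⇒≱ (s≤s ∣A∣≤4))
  Structure⇒Small ∣A∣≤4 (inflated (mkInflated v∈ w∈
      (mkTriangle a∈D b∈D c∈D a⊳b b⊳c c⊳a _ _ _) w⊳a w⊳b w⊳c v⊳w _ _ _ _))
    with ∈-D⁻ a∈D | ∈-D⁻ b∈D | ∈-D⁻ c∈D
  ... | a∈ , a⊳v | b∈ , b⊳v | c∈ , c⊳v = contradiction (unique-length
      ((⊳⇒≢ a⊳b ∷ ≢-sym (⊳⇒≢ c⊳a) ∷ ⊳⇒≢ a⊳v ∷ ≢-sym (⊳⇒≢ w⊳a) ∷ [])
       ∷ (⊳⇒≢ b⊳c ∷ ⊳⇒≢ b⊳v ∷ ≢-sym (⊳⇒≢ w⊳b) ∷ [])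
       ∷ (⊳⇒≢ c⊳v ∷ ≢-sym (⊳⇒≢ w⊳c) ∷ [])
       ∷ (⊳⇒≢ v⊳w ∷ [])
       ∷ [] ∷ [])
      (a∈ ∷ b∈ ∷ c∈ ∷ v∈ ∷ w∈ ∷ [])) (ℕ.<⇒≱ (s≤s ∣A∣≤4))

  -- Induction along τ.

  τ⊆ : ∀ k {B u} → τ T k B u → u ∈ B
  τ⊆ (suc k) (_ , ((_ , A⊆B , _) , _) , u∈A) = A⊆B u∈A

  retentive-self : ∀ k {B} → Nonempty B → Retentive T k B B
  retentive-self k B≢∅ = B≢∅ , (λ u∈B → u∈B) , λ _ _ _ _ u∈τ → proj₁ (∈-D⁻ (τ⊆ k u∈τ))

  -- Descent on cardinality: if there is no minimal set and no smaller set is retentive, a retentive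
  -- `A` would itself be minimal.
  ¬¬-minRetentive : ∀ k {B A} → Retentive T k B A → ¬ ¬ ∃ (MinRetentive T k B)
  ¬¬-minRetentive k {B} {A} ret none = go (<-wellFounded ∣ A ∣) ret
    where
    go : ∀ {A} → Acc _<_ ∣ A ∣ → ¬ Retentive T k B A
    go {A} (acc rs) ret = none (A , ret , λ A′ ret′ A′⊆A → ⊆-antisym A′⊆A λ {x} x∈A →
      decidable-stable (x ∈? A′) λ x∉A′ → go (rs (p⊂q⇒∣p∣<∣q∣ (A′⊆A , x , x∈A , x∉A′))) ret′)

  -- The bounds on ∣ B ∣ say that the fuel suffices for τ on the in-neighbourhoods in B.
  ¬¬-local : ∀ k {B A v} → ∣ B ∣ ≤ suc k → Retentive T k B A → v ∈ A → ∣ D A v ∣ ≤ 4 → ¬ ¬ Local B A v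
  ¬¬-structure : ∀ k {B A} → ∣ B ∣ ≤ suc k → Retentive T k B A → ∣ A ∣ ≤ 5 → ¬ ¬ Structure B A

  ¬¬-local k {B} {A} {v} ∣B∣≤ (A≢∅ , A⊆B , closed) v∈A ∣DA∣≤4 ¬loc with nonempty? (D B v)
  ... | no D≡∅ = ¬loc (inj₁ λ u∈B u⊳v → D≡∅ (_ , ∈-D⁺ u∈B u⊳v))
  ... | yes D≢∅ = go k (s≤s⁻¹ (≤-trans (∣D∣<∣B∣ (A⊆B v∈A)) ∣B∣≤)) (closed v v∈A D≢∅)
    where
    go : ∀ k → ∣ D B v ∣ ≤ k → (∀ u → τ T k (D B v) u → u ∈ A) → ⊥
    -- `τ` at fuel zero is empty and gives no information, but the size bound then contradicts
    -- `D≢∅`.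
    go zero ∣D∣≤0 _ = ℕ.n≮0 (≤-trans (x∈p⇒∣p-x∣<∣p∣ (proj₂ D≢∅)) ∣D∣≤0)
    go (suc k) ∣D∣≤ τ⊆A = ¬¬-minRetentive k (retentive-self k D≢∅) λ where
      -- Being part of `τ`, the set `A′` lies in `A`, hence in `D A v`, and so has at most four
      -- vertices.
      (A′ , min@(ret@(_ , A′⊆D , _) , _)) →
        let A′⊆DA : A′ ⊆ D A v
            A′⊆DA u∈A′ = ∈-D⁺ (τ⊆A _ (A′ , min , u∈A′)) (proj₂ (∈-D⁻ {B} (A′⊆D u∈A′)))
            ∣A′∣≤4 = ≤-trans (p⊆q⇒∣p∣≤∣q∣ A′⊆DA) ∣DA∣≤4
        in ¬¬-structure k ∣D∣≤ ret (ℕ.m≤n⇒m≤1+n ∣A′∣≤4) λ s →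
          ¬loc (inj₂ (Small-mono A′⊆DA (Structure⇒Small ∣A′∣≤4 s)))

  ¬¬-structure k {B} {A} ∣B∣≤ ret@(A≢∅ , A⊆B , _) ∣A∣≤5 ¬str =
    -- Finiteness of `Fin n` lets the double negation move outside the quantifier over vertices.
    sequence (RawMonad.rawApplicative ¬¬-Monad) local-if-member λ loc →
      ¬str (structure A⊆B ∣A∣≤5 (λ {v} → loc v) A≢∅)
    where
    local-if-member : ∀ v → ¬ ¬ (v ∈ A → Local B A v)
    local-if-member v ¬loc with v ∈? A
    ... | yes v∈A = ¬¬-local k ∣B∣≤ ret v∈A (s≤s⁻¹ (≤-trans (∣D∣<∣B∣ v∈A) ∣A∣≤5)) λ loc → ¬loc λ _ → loc
    ... | no v∉A = ¬loc λ v∈A → contradiction v∈A v∉A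

  -- A vertex of small in-degree.

  -- The in-degrees in A have the same sum as the out-degrees.
  ¬min-indegree≥5 : ∀ {A} → Nonempty A → ∣ A ∣ ≤ 10 → ¬ (∀ {v} → v ∈ A → 5 ≤ ∣ D A v ∣)
  ¬min-indegree≥5 {A} (a , a∈A) ∣A∣≤10 deg≥5 =
    ℕ.n≮0 (≤-trans (x∈p⇒∣p-x∣<∣p∣ a∈A) (ℕ.+-cancelˡ-≤ (∑[ v < n ] out v) _ _ ∑out+∣A∣≤∑out))
    where
    open ℕ.≤-Reasoning

    -- Arcs with an end outside `A` count as zero, so that all sums can range over `Fin n`.
    arc : Fin n → Fin n → ℕ
    arc u v = χ (lookup A v ∧ lookup A u ∧ beats T u v)

    inn out : Fin n → ℕ
    inn v = ∑[ u < n ] arc u v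
    out v = ∑[ u < n ] arc v u

    inn≡ : ∀ {v} → v ∈ A → ∣ D A v ∣ ≡ inn v
    inn≡ {v} v∈A = trans (∣p∣≡∑χ (D A v)) (sum-cong-≗ eq)
      where
      eq : ∀ u → χ (lookup (D A v) u) ≡ arc u v
      eq u rewrite []=⇒lookup v∈A = cong χ (lookup-D A v u)

    neighbour : ∀ {u v} → lookup A u ≡ true → u ≢ v → 1 ≤ χ (lookup (A - v) u)
    neighbour {u} {v} u∈A u≢v =
      ≤-reflexive (cong χ (sym ([]=⇒lookup (x∈p∧x≢y⇒x∈p-y (lookup⇒[]= u A u∈A) u≢v))))

    arcs≤ : ∀ v u → arc u v + arc v u ≤ χ (lookup (A - v) u)
    arcs≤ v u with lookup A v | lookup A u in u∈A | beats T u v in u⊳v | beats T v u in v⊳u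
    ... | false | false | _ | _ = z≤n
    ... | false | true | _ | _ = z≤n
    ... | true | false | _ | _ = z≤n
    ... | true | true | false | false = z≤n
    ... | true | true | false | true = neighbour u∈A (≢-sym (⊳⇒≢ v⊳u))
    ... | true | true | true | false = neighbour u∈A (⊳⇒≢ u⊳v)
    ... | true | true | true | true = contradiction v⊳u (⊳-asym u⊳v)

    inn+out≤9 : ∀ {v} → v ∈ A → inn v + out v ≤ 9
    inn+out≤9 {v} v∈A = s≤s⁻¹ (begin-strict
      inn v + out v                          ≡⟨ ∑-distrib-+ (λ u → arc u v) (arc v) ⟨
      ∑[ u < n ] (arc u v + arc v u)         ≤⟨ sum-mono-≤ (arcs≤ v) ⟩
      ∑[ u < n ] χ (lookup (A - v) u)        ≡⟨ ∣p∣≡∑χ (A - v) ⟨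
      ∣ A - v ∣                              <⟨ x∈p⇒∣p-x∣<∣p∣ v∈A ⟩
      ∣ A ∣                                  ≤⟨ ∣A∣≤10 ⟩
      10                                     ∎)

    out<inn : ∀ {v} → v ∈ A → out v < inn v
    -- From `5 + out v ≤ 9` follows `out v ≤ 4`.
    out<inn {v} v∈A = ≤-trans (s≤s (ℕ.+-cancelˡ-≤ 5 _ 4 (≤-trans (ℕ.+-monoˡ-≤ (out v) 5≤) (inn+out≤9 v∈A)))) 5≤
      where
      5≤ : 5 ≤ inn v
      5≤ = ≤-trans (deg≥5 v∈A) (≤-reflexive (inn≡ v∈A))

    -- The term `χ` records the strictness at vertices of `A`; summed over all vertices it
    -- contributes `∣ A ∣`, which is thereby forced to be zero.
    out+χ≤inn : ∀ v → out v + χ (lookup A v) ≤ inn v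
    out+χ≤inn v = go (lookup A v) refl
      where
      go : ∀ b → lookup A v ≡ b → out v + χ b ≤ inn v
      go true v∈A = ≤-trans (≤-reflexive (ℕ.+-comm (out v) 1)) (out<inn (lookup⇒[]= v A v∈A))
      go false v∉A = ≤-trans (≤-reflexive (ℕ.+-identityʳ _)) (sum-mono-≤ no-arc)
        where
        no-arc : ∀ u → arc v u ≤ arc u v
        no-arc u rewrite v∉A with lookup A u
        ... | true = z≤n
        ... | false = z≤n

    ∑out+∣A∣≤∑out : ∑[ v < n ] out v + ∣ A ∣ ≤ ∑[ v < n ] out v + 0
    ∑out+∣A∣≤∑out = begin
      ∑[ v < n ] out v + ∣ A ∣                          ≡⟨ cong (∑[ v < n ] out v +_) (∣p∣≡∑χ A) ⟩
      ∑[ v < n ] out v + ∑[ v < n ] χ (lookup A v)      ≡⟨ ∑-distrib-+ out (χ ∘ lookup A) ⟨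
      ∑[ v < n ] (out v + χ (lookup A v))               ≤⟨ sum-mono-≤ out+χ≤inn ⟩
      ∑[ v < n ] inn v                                  ≡⟨ ∑-comm (λ v u → arc u v) ⟩
      ∑[ v < n ] out v                                  ≡⟨ ℕ.+-identityʳ _ ⟨
      ∑[ v < n ] out v + 0                              ∎

  -- Excluding each structure of `R₁` against a disjoint `R₂`.

  module _ {R₁ R₂ : Subset n} (disjoint : ∀ {x} → x ∈ R₁ → x ∉ R₂) where

    compare : ∀ {x r} → x ∈ R₂ → r ∈ R₁ → x ⊳ r ⊎ r ⊳ x
    compare x∈ r∈ = ⊳-total λ { refl → disjoint r∈ x∈ }

    -- As a vertex of `D ⊤ v`, where the 3-cycle has disjoint in-neighbourhoods, `r` dominates at
    -- most one of `x`, `y`, `z`.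
    majority : ∀ {v x y z r} → Triangle (D ⊤ v) (D R₂ v) x y z → r ∈ R₁ → r ⊳ v →
      (x ⊳ r × y ⊳ r) ⊎ (y ⊳ r × z ⊳ r) ⊎ (z ⊳ r × x ⊳ r)
    majority (mkTriangle x∈D y∈D z∈D _ _ _ xy yz zx) r∈ r⊳v
      with compare (proj₁ (∈-D⁻ x∈D)) r∈ | compare (proj₁ (∈-D⁻ y∈D)) r∈ | compare (proj₁ (∈-D⁻ z∈D)) r∈
    ... | inj₁ x⊳r | inj₁ y⊳r | _ = inj₁ (x⊳r , y⊳r)
    ... | _ | inj₁ y⊳r | inj₁ z⊳r = inj₂ (inj₁ (y⊳r , z⊳r))
    ... | inj₁ x⊳r | _ | inj₁ z⊳r = inj₂ (inj₂ (z⊳r , x⊳r))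
    ... | inj₂ r⊳x | inj₂ r⊳y | _ = contradiction r⊳y (xy (∈-D⁺ ∈⊤ r⊳v) r⊳x)
    ... | _ | inj₂ r⊳y | inj₂ r⊳z = contradiction r⊳z (yz (∈-D⁺ ∈⊤ r⊳v) r⊳y)
    ... | inj₂ r⊳x | _ | inj₂ r⊳z = contradiction r⊳x (zx (∈-D⁺ ∈⊤ r⊳v) r⊳z)

    -- An undominated vertex of `D ⊤ v` in `R₂` dominates both `r` and `s`; in the case of a
    -- 3-cycle, the two majorities among its three vertices meet.
    ¬exclusive-pair : ∀ {v r s} → Local ⊤ R₂ v → r ∈ R₁ → s ∈ R₁ → Exclusive ⊤ r s → r ⊳ v → ¬ s ⊳ v
    ¬exclusive-pair (inj₁ v!) _ _ _ r⊳v _ = v! ∈⊤ r⊳v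
    ¬exclusive-pair (inj₂ (source p∈D p!)) r∈ s∈ rs r⊳v s⊳v
      with compare (proj₁ (∈-D⁻ p∈D)) r∈ | compare (proj₁ (∈-D⁻ p∈D)) s∈
    ... | inj₁ p⊳r | inj₁ p⊳s = rs ∈⊤ p⊳r p⊳s
    ... | inj₂ r⊳p | _ = p! (∈-D⁺ ∈⊤ r⊳v) r⊳p
    ... | _ | inj₂ s⊳p = p! (∈-D⁺ ∈⊤ s⊳v) s⊳p
    ¬exclusive-pair (inj₂ (cycle t)) r∈ s∈ rs r⊳v s⊳v with majority t r∈ r⊳v | majority t s∈ s⊳v
    ... | inj₁ (x⊳r , _) | inj₁ (x⊳s , _) = rs ∈⊤ x⊳r x⊳s
    ... | inj₁ (_ , y⊳r) | inj₂ (inj₁ (y⊳s , _)) = rs ∈⊤ y⊳r y⊳s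
    ... | inj₁ (x⊳r , _) | inj₂ (inj₂ (_ , x⊳s)) = rs ∈⊤ x⊳r x⊳s
    ... | inj₂ (inj₁ (y⊳r , _)) | inj₁ (_ , y⊳s) = rs ∈⊤ y⊳r y⊳s
    ... | inj₂ (inj₁ (y⊳r , _)) | inj₂ (inj₁ (y⊳s , _)) = rs ∈⊤ y⊳r y⊳s
    ... | inj₂ (inj₁ (_ , z⊳r)) | inj₂ (inj₂ (z⊳s , _)) = rs ∈⊤ z⊳r z⊳s
    ... | inj₂ (inj₂ (_ , x⊳r)) | inj₁ (x⊳s , _) = rs ∈⊤ x⊳r x⊳s
    ... | inj₂ (inj₂ (z⊳r , _)) | inj₂ (inj₁ (_ , z⊳s)) = rs ∈⊤ z⊳r z⊳s
    ... | inj₂ (inj₂ (z⊳r , _)) | inj₂ (inj₂ (z⊳s , _)) = rs ∈⊤ z⊳r z⊳s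

    -- Both x and y dominate h, so each of them dominates at most one of the three vertices a, b, c.
    ¬cover-triangle : ∀ {h a b c x y} → Triangle (D ⊤ h) (D R₁ h) a b c → x ⊳ h → y ⊳ h →
      x ⊳ a ⊎ y ⊳ a → x ⊳ b ⊎ y ⊳ b → ¬ (x ⊳ c ⊎ y ⊳ c)
    ¬cover-triangle {h} {x = x} {y} (mkTriangle _ _ _ _ _ _ ab bc ca) x⊳h y⊳h = go
      where
      x∈D : x ∈ D ⊤ h
      x∈D = ∈-D⁺ ∈⊤ x⊳h
      y∈D : y ∈ D ⊤ h
      y∈D = ∈-D⁺ ∈⊤ y⊳h

      go : x ⊳ _ ⊎ y ⊳ _ → x ⊳ _ ⊎ y ⊳ _ → ¬ (x ⊳ _ ⊎ y ⊳ _)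
      go (inj₁ x⊳a) (inj₁ x⊳b) _ = ab x∈D x⊳a x⊳b
      go (inj₂ y⊳a) (inj₂ y⊳b) _ = ab y∈D y⊳a y⊳b
      go _ (inj₁ x⊳b) (inj₁ x⊳c) = bc x∈D x⊳b x⊳c
      go _ (inj₂ y⊳b) (inj₂ y⊳c) = bc y∈D y⊳b y⊳c
      go (inj₁ x⊳a) _ (inj₁ x⊳c) = ca x∈D x⊳c x⊳a
      go (inj₂ y⊳a) _ (inj₂ y⊳c) = ca y∈D y⊳c y⊳a

    -- Two of three vertices meet every pair; `rotate` supplies the pairs other than `x`, `y`.
    majority-either : ∀ {v x y z r} → Triangle (D ⊤ v) (D R₂ v) x y z → r ∈ R₁ → r ⊳ v → x ⊳ r ⊎ y ⊳ r
    majority-either s r∈ r⊳v with majority s r∈ r⊳v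
    ... | inj₁ (x⊳r , _) = inj₁ x⊳r
    ... | inj₂ (inj₁ (y⊳r , _)) = inj₂ y⊳r
    ... | inj₂ (inj₂ (_ , x⊳r)) = inj₁ x⊳r

    -- Here `h` is the field `v` of `Inflated`. Either one vertex dominates all of `h`, `a`, `b`,
    -- `c`, or two vertices of the 3-cycle in `R₂` dominate `h` and between them `a`, `b`, `c`. Both
    -- contradict `¬cover-triangle`.
    ¬inflated-vertices : ∀ {v h a b c} → Local ⊤ R₂ v → h ∈ R₁ → Triangle (D ⊤ h) (D R₁ h) a b c →
      h ⊳ v → a ⊳ v → b ⊳ v → ¬ c ⊳ v
    ¬inflated-vertices (inj₁ v!) _ _ h⊳v _ _ _ = v! ∈⊤ h⊳v
    ¬inflated-vertices {v} (inj₂ (source {p} p∈D p!)) h∈ t@(mkTriangle a∈D b∈D c∈D _ _ _ _ _ _) h⊳v a⊳v b⊳v c⊳v =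
      ¬cover-triangle t (dominates h∈ h⊳v) (dominates h∈ h⊳v) (inj₁ (dominates (proj₁ (∈-D⁻ a∈D)) a⊳v))
        (inj₁ (dominates (proj₁ (∈-D⁻ b∈D)) b⊳v)) (inj₁ (dominates (proj₁ (∈-D⁻ c∈D)) c⊳v))
      where
      dominates : ∀ {r} → r ∈ R₁ → r ⊳ v → p ⊳ r
      dominates r∈ r⊳v with compare (proj₁ (∈-D⁻ p∈D)) r∈
      ... | inj₁ p⊳r = p⊳r
      ... | inj₂ r⊳p = contradiction r⊳p (p! (∈-D⁺ ∈⊤ r⊳v))
    ¬inflated-vertices {v} {h} (inj₂ (cycle s)) h∈ t@(mkTriangle a∈D b∈D c∈D _ _ _ _ _ _) h⊳v a⊳v b⊳v c⊳v =
      case majority s h∈ h⊳v of λ where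
        (inj₁ (x⊳h , y⊳h)) → go s x⊳h y⊳h
        (inj₂ (inj₁ (y⊳h , z⊳h))) → go (rotate s) y⊳h z⊳h
        (inj₂ (inj₂ (z⊳h , x⊳h))) → go (rotate (rotate s)) z⊳h x⊳h
      where
      go : ∀ {x y z} → Triangle (D ⊤ v) (D R₂ v) x y z → x ⊳ h → ¬ y ⊳ h
      go s x⊳h y⊳h = ¬cover-triangle t x⊳h y⊳h (majority-either s (proj₁ (∈-D⁻ a∈D)) a⊳v)
        (majority-either s (proj₁ (∈-D⁻ b∈D)) b⊳v) (majority-either s (proj₁ (∈-D⁻ c∈D)) c⊳v)

    ¬structure-local : ∀ {v} → Structure ⊤ R₁ → v ∈ R₂ → ¬ Local ⊤ R₂ v
    ¬structure-local (small (source a∈ a!)) v∈ loc with compare v∈ a∈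
    ... | inj₁ v⊳a = a! ∈⊤ v⊳a
    -- An undominated vertex is exclusive with itself, so `a` can stand for both members of the
    -- pair.
    ... | inj₂ a⊳v = ¬exclusive-pair loc a∈ a∈ (λ _ u⊳a _ → a! ∈⊤ u⊳a) a⊳v a⊳v
    ¬structure-local (small (cycle (mkTriangle x∈ y∈ z∈ _ _ _ xy yz zx))) v∈ loc
      with compare v∈ x∈ | compare v∈ y∈ | compare v∈ z∈
    ... | inj₂ x⊳v | inj₂ y⊳v | _ = ¬exclusive-pair loc x∈ y∈ xy x⊳v y⊳v
    ... | _ | inj₂ y⊳v | inj₂ z⊳v = ¬exclusive-pair loc y∈ z∈ yz y⊳v z⊳v
    ... | inj₂ x⊳v | _ | inj₂ z⊳v = ¬exclusive-pair loc z∈ x∈ zx z⊳v x⊳v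
    ... | inj₁ v⊳x | inj₁ v⊳y | _ = xy ∈⊤ v⊳x v⊳y
    ... | _ | inj₁ v⊳y | inj₁ v⊳z = yz ∈⊤ v⊳y v⊳z
    ... | inj₁ v⊳x | _ | inj₁ v⊳z = zx ∈⊤ v⊳z v⊳x
    ¬structure-local (pentagon (mkPentagon _ (m₀ ∷ m₁ ∷ m₂ ∷ m₃ ∷ m₄ ∷ []) e₀ e₁ e₂ e₃ e₄)) v∈ loc
      -- Five is odd, so the orientations towards `v` cannot alternate around the pentagon: some
      -- consecutive pair agrees.
      with compare v∈ m₀ | compare v∈ m₁ | compare v∈ m₂ | compare v∈ m₃ | compare v∈ m₄
    ... | inj₂ d₀ | inj₂ d₁ | _ | _ | _ = ¬exclusive-pair loc m₁ m₀ e₀ d₁ d₀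
    ... | _ | inj₂ d₁ | inj₂ d₂ | _ | _ = ¬exclusive-pair loc m₂ m₁ e₁ d₂ d₁
    ... | _ | _ | inj₂ d₂ | inj₂ d₃ | _ = ¬exclusive-pair loc m₃ m₂ e₂ d₃ d₂
    ... | _ | _ | _ | inj₂ d₃ | inj₂ d₄ = ¬exclusive-pair loc m₄ m₃ e₃ d₄ d₃
    ... | inj₂ d₀ | _ | _ | _ | inj₂ d₄ = ¬exclusive-pair loc m₀ m₄ e₄ d₀ d₄
    ... | inj₁ d₀ | inj₁ d₁ | _ | _ | _ = e₀ ∈⊤ d₁ d₀
    ... | _ | inj₁ d₁ | inj₁ d₂ | _ | _ = e₁ ∈⊤ d₂ d₁
    ... | _ | _ | inj₁ d₂ | inj₁ d₃ | _ = e₂ ∈⊤ d₃ d₂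
    ... | _ | _ | _ | inj₁ d₃ | inj₁ d₄ = e₃ ∈⊤ d₄ d₃
    ... | inj₁ d₀ | _ | _ | _ | inj₁ d₄ = e₄ ∈⊤ d₀ d₄
    ¬structure-local (inflated (mkInflated h∈ w∈ t@(mkTriangle a∈D b∈D c∈D _ _ _ _ _ _) _ _ _ _ wa wb wc hw)) v∈ loc
      with ∈-D⁻ a∈D | ∈-D⁻ b∈D | ∈-D⁻ c∈D
    ... | a∈ , _ | b∈ , _ | c∈ , _
      -- Since `w` is exclusive with each of the other four, these must all be oriented towards `v`
      -- oppositely to `w`.
      with compare v∈ w∈ | compare v∈ h∈ | compare v∈ a∈ | compare v∈ b∈ | compare v∈ c∈
    ... | inj₂ w⊳v | inj₂ h⊳v | _ | _ | _ = ¬exclusive-pair loc h∈ w∈ hw h⊳v w⊳v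
    ... | inj₂ w⊳v | _ | inj₂ a⊳v | _ | _ = ¬exclusive-pair loc w∈ a∈ wa w⊳v a⊳v
    ... | inj₂ w⊳v | _ | _ | inj₂ b⊳v | _ = ¬exclusive-pair loc w∈ b∈ wb w⊳v b⊳v
    ... | inj₂ w⊳v | _ | _ | _ | inj₂ c⊳v = ¬exclusive-pair loc w∈ c∈ wc w⊳v c⊳v
    ... | inj₂ _ | inj₁ v⊳h | inj₁ v⊳a | inj₁ v⊳b | inj₁ v⊳c =
      ¬cover-triangle t v⊳h v⊳h (inj₁ v⊳a) (inj₁ v⊳b) (inj₁ v⊳c)
    ... | inj₁ v⊳w | inj₁ v⊳h | _ | _ | _ = hw ∈⊤ v⊳h v⊳w
    ... | inj₁ v⊳w | _ | inj₁ v⊳a | _ | _ = wa ∈⊤ v⊳w v⊳a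
    ... | inj₁ v⊳w | _ | _ | inj₁ v⊳b | _ = wb ∈⊤ v⊳w v⊳b
    ... | inj₁ v⊳w | _ | _ | _ | inj₁ v⊳c = wc ∈⊤ v⊳w v⊳c
    ... | inj₁ _ | inj₂ h⊳v | inj₂ a⊳v | inj₂ b⊳v | inj₂ c⊳v =
      ¬inflated-vertices loc h∈ t h⊳v a⊳v b⊳v c⊳v

  -- A common vertex would make the intersection nonempty and hence retentive, and minimality would
  -- equate it with both sets.
  minRetentive-disjoint : ∀ k {B R₁ R₂} → MinRetentive T k B R₁ → MinRetentive T k B R₂ → R₁ ≢ R₂ →
    ∀ {x} → x ∈ R₁ → x ∉ R₂
  minRetentive-disjoint k {B} {R₁} {R₂} ((_ , R₁⊆B , closed₁) , min₁) ((_ , _ , closed₂) , min₂) R₁≢R₂ x∈R₁ x∈R₂ =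
    R₁≢R₂ (trans (sym (min₁ (R₁ ∩ R₂) ret (p∩q⊆p R₁ R₂))) (min₂ (R₁ ∩ R₂) ret (p∩q⊆q R₁ R₂)))
    where
    ret : Retentive T k B (R₁ ∩ R₂)
    ret = (_ , x∈p∩q⁺ (x∈R₁ , x∈R₂)) , (λ u∈ → R₁⊆B (p∩q⊆p R₁ R₂ u∈)) , λ v v∈ D≢∅ u u∈τ →
      x∈p∩q⁺ (closed₁ v (p∩q⊆p R₁ R₂ v∈) D≢∅ u u∈τ , closed₂ v (p∩q⊆q R₁ R₂ v∈) D≢∅ u u∈τ)

theorem5 : (k : ℕ) → 1 ≤ k → k ≤ 10 →
    (n : ℕ) (T : Tournament n) (R₁ R₂ : Subset n) →
    IsMinimalTauRetentive T R₁ → IsMinimalTauRetentive T R₂ →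
    R₁ ≢ R₂ → ∣ R₁ ∣ ≡ 5 → ∣ R₂ ∣ ≡ k → ⊥
theorem5 k _ k≤10 n T R₁ R₂ min₁@(ret₁ , _) min₂@(ret₂@(R₂≢∅ , _) , _) R₁≢R₂ ∣R₁∣≡5 ∣R₂∣≡k =
  ¬min-indegree≥5 T R₂≢∅ (≤-trans (≤-reflexive ∣R₂∣≡k) k≤10) λ v∈R₂ → ℕ.≰⇒> λ ∣D∣≤4 →
    ¬¬-structure T n ∣⊤∣≤1+n ret₁ (≤-reflexive ∣R₁∣≡5) λ str →
    ¬¬-local T n ∣⊤∣≤1+n ret₂ v∈R₂ ∣D∣≤4
      (¬structure-local T (minRetentive-disjoint T n min₁ min₂ R₁≢R₂) str v∈R₂)
  where
  -- Fuel `n` for the in-neighbourhoods would serve even `suc n` vertices.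
  ∣⊤∣≤1+n : ∣ ⊤ {n} ∣ ≤ suc n
  ∣⊤∣≤1+n = ℕ.m≤n⇒m≤1+n (∣p∣≤n ⊤)
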